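{- Let $a$, $b$, $c$ be digits with $b\ge c$, and put $a^+=a+1$. Then: (1) if either ($a\ge c$ and $\delta(a^+,c)=\delta(a,c)$) or ($a<c$ and $\delta(a^+,c)\ne\delta(a,c)$), then $$(a,b)\bowtie c=a^+\clubsuit c+\delta(b,c);$$ (2) if either ($a\ge c$ and $\delta(a^+,c)\ne\delta(a,c)$) or ($a<c$ and $\delta(a^+,c)=\delta(a,c)$), then $$(a,b)\bowtie c=(a^+\clubsuit c+10)+\delta(b,c).$$
   Context: A digit is an element of $\{0,1,\dots,9\}$. For nonnegative integers $x,y$, let $u\in\{0,\dots,9\}$ be the ones digit of the usual product $x\times y$. The plum-blossom product $x\clubsuit y$ is defined by $x\clubsuit y=u$ if $u\le 3$, and $x\clubsuit y=u-10$ if $u>3$. The carry $J(x\clubsuit y)$ is the integer determined by $x\times y=10\,J(x\clubsuit y)+x\clubsuit y$; it depends on the pair $(x,y)$, not only on the value $x\clubsuit y$. The integer $\delta(x,y)$ is defined by $J(x\clubsuit y)=\min(x,y)+\delta(x,y)$. These definitions are also used when $a^+=10$ (the case $a=9$). For digits $a,b,c$, the plum-blossom wedge product of $(a,b)$ and $c$ is $(a,b)\bowtie c=a\clubsuit c+J(b\clubsuit c)$. -}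

module Defs where

open import Data.Bool using (if_then_else_; true; false)
open import Data.Fin using (Fin; toℕ)
open import Data.Integer using (ℤ; +_; _+_; _-_; _*_)
open import Data.Integer.DivMod using (_/ℕ_)
open import Data.Integer.Properties using (pos-*; *-cancelˡ-≡; +-0-abelianGroup)
open import Data.Integer.Tactic.RingSolver using (solve-∀)
open import Data.Nat as ℕ using (ℕ; suc; _≤ᵇ_; _⊓_)
import Data.Nat.DivMod as ℕ
open import Data.Product using (∃-syntax; _×_; _,_)
open import Algebra.Properties.AbelianGroup +-0-abelianGroup using () renaming (∙-cancelʳ to +-cancelʳ)
open import Relation.Binary.PropositionalEquality using (_≡_; sym; trans; cong)

infixl 7 _♣_ _⋈_

Digit : Set
Digit = Fin 10

_♣_ : ℕ → ℕ → ℤ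
x ♣ y = let u = (x ℕ.* y) ℕ.% 10 in
  if u ≤ᵇ 3 then + u else + u - + 10

-- J x y is the carry written J(x ♣ y) in prose; it depends on the pair (x , y).
-- The division is exact, and J x y is the unique solution of the defining
-- equation: see J-spec and J-unique.
J : ℕ → ℕ → ℤ
J x y = (+ (x ℕ.* y) - x ♣ y) /ℕ 10

δ : ℕ → ℕ → ℤ
δ x y = J x y - + (x ⊓ y)

_⋈_ : Digit × Digit → Digit → ℤ
(a , b) ⋈ c = toℕ a ♣ toℕ c + J (toℕ b) (toℕ c)

-- A natural number, not a Digit: it is 10 when a is 9.
_⁺ : Digit → ℕ
a ⁺ = suc (toℕ a)

private
  decompose : ∀ x y → ∃[ q ] + (x ℕ.* y) ≡ + 10 * + q + x ♣ y
  decompose x y = cases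
    where
    r = (x ℕ.* y) ℕ.% 10
    q = (x ℕ.* y) ℕ./ 10
    divMod : + (x ℕ.* y) ≡ + r + + q * + 10
    divMod = trans (cong +_ (ℕ.m≡m%n+[m/n]*n (x ℕ.* y) 10))
                   (cong (λ t → + r + t) (pos-* q 10))
    keep : ∀ s t → s + t * + 10 ≡ + 10 * t + s
    keep = solve-∀
    shift : ∀ s t → s + t * + 10 ≡ + 10 * (+ 1 + t) + (s - + 10)
    shift = solve-∀
    cases : ∃[ q ] + (x ℕ.* y) ≡ + 10 * + q + x ♣ y
    cases with r ≤ᵇ 3
    ... | true  = q , trans divMod (keep (+ r) (+ q))
    ... | false = suc q , trans divMod (shift (+ r) (+ q))

J-spec : ∀ x y → + (x ℕ.* y) ≡ + 10 * J x y + x ♣ y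
J-spec x y with q , eq ← decompose x y =
  trans eq (cong (λ j → + 10 * j + x ♣ y) (sym J≡q))
  where
  lemma : ∀ s t → (+ 10 * s + t) - t ≡ s * + 10
  lemma = solve-∀
  J≡q : J x y ≡ + q
  J≡q = trans
    (cong (_/ℕ 10) (trans (cong (_- x ♣ y) eq)
                   (trans (lemma (+ q) (x ♣ y)) (sym (pos-* q 10)))))
    (cong +_ (ℕ.m*n/n≡m q 10))

J-unique : ∀ x y j → + (x ℕ.* y) ≡ + 10 * j + x ♣ y → j ≡ J x y
J-unique x y j eq =
  *-cancelˡ-≡ (+ 10) j (J x y)
    (+-cancelʳ (x ♣ y) (+ 10 * j) (+ 10 * J x y)
      (trans (sym eq) (J-spec x y)))

{-# OPTIONS --safe #-}

-- Comparing a⁺ c = a c + c with the carry decompositions of a⁺ c and a c gives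
--   a ♣ c + c = a⁺ ♣ c + 10 (J (a⁺ ♣ c) − J (a ♣ c)),
-- and J (b ♣ c) = c + δ (b , c) because b ≥ c.  The carry increment is 0 or 1,
-- and it equals min (a⁺ , c) − min (a , c) exactly when δ does not change;
-- that difference of minima is 0 if a ≥ c and 1 if a < c.
module Submission where

open import Defs
open import Data.Fin using (toℕ; _≥_; _<_)
open import Data.Fin.Properties using (all?)
open import Data.Integer using (ℤ; +_; _+_; _-_; _*_; -_; _≟_)
open import Data.Integer.Properties using (+-assoc; +-0-abelianGroup)
open import Data.Integer.Tactic.RingSolver using (solve-∀)
open import Data.Nat as ℕ using (ℕ; suc)
open import Data.Nat.Properties using (m≤n⇒m⊓n≡m; m≥n⇒m⊓n≡n; m≤n⇒m≤1+n; <⇒≤)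
open import Data.Product using (_×_; _,_)
open import Data.Sum using (_⊎_; inj₁; inj₂; fromInj₁; fromInj₂)
open import Algebra.Properties.AbelianGroup +-0-abelianGroup using () renaming (∙-cancelʳ to +-cancelʳ)
open import Function using (_∘_)
open import Function.Bundles using (_⇔_; mk⇔; module Equivalence)
open import Relation.Binary.PropositionalEquality using (_≡_; _≢_; sym; trans; cong; module ≡-Reasoning)
open import Relation.Nullary using (contradiction)
open import Relation.Nullary.Decidable using (_⊎-dec_; from-yes)

open Equivalence using (to; from)

-- A product `n` has carry ⌊(n + 6) / 10⌋, since a last digit above 3 rounds up; passing from `a` to
-- `a ⁺` adds `toℕ c`, at most 9, to the product, so this floor rises by at most one. The proof
-- evaluates all hundred pairs, among them those with `a ⁺` equal to 10.
J-suc : (a c : Digit) →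
  J (a ⁺) (toℕ c) ≡ J (toℕ a) (toℕ c) ⊎ J (a ⁺) (toℕ c) ≡ + 1 + J (toℕ a) (toℕ c)
J-suc = from-yes (all? {n = 10} λ a → all? {n = 10} λ c →
  (J (a ⁺) (toℕ c) ≟ J (toℕ a) (toℕ c)) ⊎-dec (J (a ⁺) (toℕ c) ≟ + 1 + J (toℕ a) (toℕ c)))

♣-suc : ∀ x y → x ♣ y + + y ≡ suc x ♣ y + + 10 * (J (suc x) y - J x y)
♣-suc x y = begin
  x ♣ y + + y                                    ≡⟨ isolate (+ 10 * J x y) (x ♣ y) (+ y) ⟩
  -- Here `+ y + + (x ℕ.* y)` and `+ (suc x ℕ.* y)` agree by computation, so `J-spec x y` read
  -- backwards lands on the product for `suc x`.
  + y + (+ 10 * J x y + x ♣ y) - + 10 * J x y    ≡⟨ cong (λ p → + y + p - + 10 * J x y) (J-spec x y) ⟨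
  + (suc x ℕ.* y) - + 10 * J x y                 ≡⟨ cong (_- + 10 * J x y) (J-spec (suc x) y) ⟩
  + 10 * J (suc x) y + suc x ♣ y - + 10 * J x y  ≡⟨ collect (J (suc x) y) (J x y) (suc x ♣ y) ⟩
  suc x ♣ y + + 10 * (J (suc x) y - J x y)       ∎
  where
  open ≡-Reasoning
  isolate : ∀ t s y → s + y ≡ y + (t + s) - t
  isolate = solve-∀
  collect : ∀ j k s → + 10 * j + s - + 10 * k ≡ s + + 10 * (j - k)
  collect = solve-∀

J≡y+δ : ∀ {x y} → y ℕ.≤ x → J x y ≡ + y + δ x y
J≡y+δ {x} {y} y≤x = trans (split (+ y) (J x y)) (cong (λ m → + y + (J x y - + m)) (sym (m≥n⇒m⊓n≡n y≤x)))
  where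
  split : ∀ m j → j ≡ m + (j - m)
  split = solve-∀

-- The summand `+ toℕ c` that `b ≥ c` splits off the carry of the second product is exactly what
-- `♣-suc` absorbs. Only the carry increment then remains to be determined.
⋈-formula : (a b c : Digit) → b ≥ c →
  (a , b) ⋈ c ≡ a ⁺ ♣ toℕ c + + 10 * (J (a ⁺) (toℕ c) - J (toℕ a) (toℕ c)) + δ (toℕ b) (toℕ c)
⋈-formula a b c b≥c = begin
  toℕ a ♣ toℕ c + J (toℕ b) (toℕ c)                    ≡⟨ cong (_+_ (toℕ a ♣ toℕ c)) (J≡y+δ b≥c) ⟩
  toℕ a ♣ toℕ c + (+ toℕ c + δ (toℕ b) (toℕ c))        ≡⟨ +-assoc (toℕ a ♣ toℕ c) (+ toℕ c) (δ (toℕ b) (toℕ c)) ⟨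
  toℕ a ♣ toℕ c + + toℕ c + δ (toℕ b) (toℕ c)          ≡⟨ cong (_+ δ (toℕ b) (toℕ c)) (♣-suc (toℕ a) (toℕ c)) ⟩
  a ⁺ ♣ toℕ c + + 10 * (J (a ⁺) (toℕ c) - J (toℕ a) (toℕ c)) + δ (toℕ b) (toℕ c) ∎
  where
  open ≡-Reasoning

δ-suc-≥ : ∀ {x y} → y ℕ.≤ x → δ (suc x) y ≡ δ x y ⇔ J (suc x) y ≡ J x y
δ-suc-≥ {x} {y} y≤x
  rewrite m≥n⇒m⊓n≡n y≤x | m≥n⇒m⊓n≡n (m≤n⇒m≤1+n y≤x) =
  mk⇔ (+-cancelʳ (- + y) _ _) (cong (_- + y))

δ-suc-< : ∀ {x y} → x ℕ.< y → δ (suc x) y ≡ δ x y ⇔ J (suc x) y ≡ + 1 + J x y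
δ-suc-< {x} {y} x<y
  -- Since `x ℕ.< y` unfolds to `suc x ℕ.≤ y`, the minima are `x` and `suc x`: the subtracted term
  -- grows by one, and equal δ forces the carry to grow by one too.
  rewrite m≤n⇒m⊓n≡m (<⇒≤ x<y) | m≤n⇒m⊓n≡m x<y =
  mk⇔ (λ eq → +-cancelʳ (- + suc x) _ _ (trans eq (shift (+ x) (J x y))))
      (λ eq → trans (cong (_- + suc x) eq) (sym (shift (+ x) (J x y))))
  where
  shift : ∀ m j → j - m ≡ + 1 + j - (+ 1 + m)
  shift = solve-∀

theorem3 : (a b c : Digit) → b ≥ c →
    (((a ≥ c × δ (a ⁺) (toℕ c) ≡ δ (toℕ a) (toℕ c))
    ⊎ (a < c × δ (a ⁺) (toℕ c) ≢ δ (toℕ a) (toℕ c))) →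
    (a , b) ⋈ c ≡ (a ⁺) ♣ toℕ c + δ (toℕ b) (toℕ c))
    ×
    (((a ≥ c × δ (a ⁺) (toℕ c) ≢ δ (toℕ a) (toℕ c))
    ⊎ (a < c × δ (a ⁺) (toℕ c) ≡ δ (toℕ a) (toℕ c))) →
    (a , b) ⋈ c ≡ ((a ⁺) ♣ toℕ c + + 10) + δ (toℕ b) (toℕ c))
theorem3 a b c b≥c = unchanged ∘ carry-unchanged , increased ∘ carry-increased
  where
  j j⁺ s d : ℤ
  j  = J (toℕ a) (toℕ c)
  j⁺ = J (a ⁺) (toℕ c)
  s  = a ⁺ ♣ toℕ c
  d  = δ (toℕ b) (toℕ c)

  carry-unchanged :
    (a ≥ c × δ (a ⁺) (toℕ c) ≡ δ (toℕ a) (toℕ c)) ⊎ (a < c × δ (a ⁺) (toℕ c) ≢ δ (toℕ a) (toℕ c)) →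
    j⁺ ≡ j
  carry-unchanged (inj₁ (a≥c , eq)) = to (δ-suc-≥ a≥c) eq
  carry-unchanged (inj₂ (a<c , neq)) =
    -- An increment of one would keep δ fixed, against `neq`, so `J-suc` leaves only zero.
    fromInj₁ (λ eq → contradiction (from (δ-suc-< a<c) eq) neq) (J-suc a c)

  carry-increased :
    (a ≥ c × δ (a ⁺) (toℕ c) ≢ δ (toℕ a) (toℕ c)) ⊎ (a < c × δ (a ⁺) (toℕ c) ≡ δ (toℕ a) (toℕ c)) →
    j⁺ ≡ + 1 + j
  carry-increased (inj₁ (a≥c , neq)) =
    -- Here it is the increment zero that would keep δ fixed.
    fromInj₂ (λ eq → contradiction (from (δ-suc-≥ a≥c) eq) neq) (J-suc a c)
  carry-increased (inj₂ (a<c , eq)) = to (δ-suc-< a<c) eq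

  unchanged : j⁺ ≡ j → (a , b) ⋈ c ≡ s + d
  unchanged eq = trans (⋈-formula a b c b≥c)
    (trans (cong (λ k → s + + 10 * (k - j) + d) eq) (cancel s j d))
    where
    cancel : ∀ s j d → s + + 10 * (j - j) + d ≡ s + d
    cancel = solve-∀

  increased : j⁺ ≡ + 1 + j → (a , b) ⋈ c ≡ (s + + 10) + d
  increased eq = trans (⋈-formula a b c b≥c)
    (trans (cong (λ k → s + + 10 * (k - j) + d) eq) (cancel s j d))
    where
    cancel : ∀ s j d → s + + 10 * (+ 1 + j - j) + d ≡ (s + + 10) + d
    cancel = solve-∀
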